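{- Let $s,t\ge1$ be coprime integers. Then the $t$-core $\lambda^t$ of an $s$-core $\lambda$ is uniquely determined by the multiset of residues modulo $t$ of the elements of $\mathcal{S}_s(\lambda)$. Moreover, two $s$-cores $\lambda,\mu$ satisfy $\lambda^t=\mu^t$ if and only if the multisets of residues modulo $t$ of $\mathcal{S}_s(\lambda)$ and of $\mathcal{S}_s(\mu)$ are equal.
   Context: A partition is an infinite weakly decreasing sequence $\lambda=(\lambda_1,\lambda_2,\ldots)$ of nonnegative integers with finite sum. Its Young diagram is $[\lambda]=\{(r,c)\in\mathbb{Z}_{>0}^2 : c\le\lambda_r\}$, its conjugate $\overline{\lambda}$ is given by $\overline{\lambda}_r=\#\{c\in\mathbb{Z}_{>0}: r\le\lambda_c\}$. The rim hook of $(r,c)\in[\lambda]$ is $\{(i,j)\in[\lambda]: i\ge r,\ j\ge c,\ (i+1,j+1)\notin[\lambda]\}$, of length $1+(\lambda_r-r)+(\overline{\lambda}_c-c)$; removing it leaves the Young diagram of a smaller partition. A partition is an $s$-core if it has no rim hook of length $s$. For any partition $\lambda$ and $t\ge1$, repeatedly removing rim hooks of length $t$ until none remains yields a $t$-core, independent of the choices made, denoted $\lambda^t$ and called the $t$-core of $\lambda$. The beta-set of $\lambda$ is $B^\lambda=\{\lambda_i-i: i\ge1\}\subset\mathbb{Z}$. For an $s$-core $\lambda$, the $s$-set of $\lambda$ is $\mathcal{S}_s(\lambda)=(B^\lambda+s)\setminus B^\lambda$, a set of $s$ integers, one in each residue class modulo $s$. -}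

module Defs where

open import Data.Nat.Base as ℕ using (ℕ; zero; suc; pred; NonZero; _≤_; _<_; z≤n; s≤s; _⊔_; _⊓_)
import Data.Nat.Properties as ℕₚ
open import Data.Nat.Induction using (<-wellFounded)
open import Data.Integer.Base as ℤ using (ℤ; +_; 1ℤ; ∣_∣)
import Data.Integer.Properties as ℤₚ
open import Algebra.Properties.AbelianGroup ℤₚ.+-0-abelianGroup using () renaming (∙-cancelʳ to +-cancelʳ)
open import Data.Integer.DivMod using (_%ℕ_)
open import Data.List.Base using (List; length; filter; map; upTo)
open import Data.List.Membership.Propositional using (_∈_)
open import Data.List.Membership.Propositional.Properties
  using (∈-filter⁺; ∈-filter⁻; ∈-map⁺; ∈-map⁻; ∈-upTo⁺)
open import Data.List.Relation.Unary.Unique.Propositional using (Unique)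
import Data.List.Relation.Unary.Unique.Propositional.Properties as Uniqueₚ
open import Data.Product.Base using (∃; ∃-syntax; _×_; _,_; proj₁; proj₂)
open import Data.Sum.Base using (inj₁; inj₂; [_,_]′)
open import Function.Bundles using (_⇔_; mk⇔)
open import Induction.WellFounded using (Acc; acc)
open import Relation.Binary.Construct.Closure.ReflexiveTransitive using (Star; ε; _◅_)
open import Relation.Binary.Definitions using (tri<; tri≈; tri>)
open import Relation.Binary.PropositionalEquality
open import Relation.Nullary using (¬_; Dec; yes; no; ¬?; contradiction)
open import Relation.Nullary.Decidable using (map′)

-- Rows and columns are indexed from 0, so  part p i  is λ_{i+1}.
-- For a weakly decreasing sequence of naturals, having finite sum is the same
-- as being eventually zero; `bound` need not be the least possible, and two
-- partitions are compared by _≈_, which ignores it.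
record Partition : Set where
  field
    part       : ℕ → ℕ
    decreasing : ∀ i → part (suc i) ≤ part i
    bound      : ℕ
    vanishes   : ∀ i → bound ≤ i → part i ≡ 0

open Partition public

infix 4 _≈_
_≈_ : Partition → Partition → Set
p ≈ q = ∀ i → part p i ≡ part q i

Cell : Partition → ℕ → ℕ → Set
Cell p r c = c < part p r

RimHook : Partition → ℕ → ℕ → ℕ → ℕ → Set
RimHook p r c i j = Cell p i j × r ≤ i × c ≤ j × ¬ Cell p (suc i) (suc j)

-- The number of rows of length at least c + 1; rows from `bound p` on are empty.
conjugate : Partition → ℕ → ℕ
conjugate p c = length (filter (λ i → c ℕₚ.<? part p i) (upTo (bound p)))

-- 1 + (λ_r − r) + (λ̄_c − c), with r and c shifted to start from 0.
hookLength : Partition → ℕ → ℕ → ℤ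
hookLength p r c =
  1ℤ ℤ.+ (+ part p r ℤ.- + suc r) ℤ.+ (+ conjugate p c ℤ.- + suc c)

IsCore : ℕ → Partition → Set
IsCore s p = ∀ r c → Cell p r c → hookLength p r c ≢ + s

RemoveHook : ℕ → Partition → Partition → Set
RemoveHook t p q =
  ∃[ r ] ∃[ c ] Cell p r c × hookLength p r c ≡ + t ×
    (∀ i j → Cell q i j ⇔ (Cell p i j × ¬ RimHook p r c i j))

-- q is a result of removing rim hooks of length t from p until none remains.
-- Such a q always exists (see `core-exists` below).
IsCoreOf : ℕ → Partition → Partition → Set
IsCoreOf t p q = Star (RemoveHook t) p q × IsCore t q

beta : Partition → ℕ → ℤ
beta p i = + part p i ℤ.- + suc i

BetaSet : Partition → ℤ → Set
BetaSet p x = ∃[ i ] beta p i ≡ x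

-- (B + s) \ B
SSet : ℕ → Partition → ℤ → Set
SSet s p x = (∃[ b ] BetaSet p b × b ℤ.+ + s ≡ x) × ¬ BetaSet p x

private
  beta≡⇒< : ∀ p x i → beta p i ≡ x → i < bound p ℕ.+ ∣ x ∣
  beta≡⇒< p x i refl with ℕₚ.<-≤-connex i (bound p)
  ... | inj₁ i<b = ℕₚ.≤-trans i<b (ℕₚ.m≤m+n _ _)
  ... | inj₂ b≤i rewrite vanishes p i b≤i = ℕₚ.m≤n+m (suc i) (bound p)

betaSet? : ∀ p x → Dec (BetaSet p x)
betaSet? p x =
  map′ (λ (i , _ , eq) → i , eq)
       (λ (i , eq) → i , beta≡⇒< p x i eq , eq)
       (ℕₚ.anyUpTo? (λ i → beta p i ℤₚ.≟ x) (bound p ℕ.+ ∣ x ∣))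

-- The elements of (B + s) \ B, each listed once (`sSet-correct`, `sSet-unique`).
-- For i ≥ bound p + s the number  beta p i + s  equals  beta p (i − s)  and so
-- lies in B; only smaller i need to be considered.
sSet : ℕ → Partition → List ℤ
sSet s p =
  filter (λ x → ¬? (betaSet? p x))
         (map (λ i → beta p i ℤ.+ + s) (upTo (bound p ℕ.+ s)))

-- Lists represent multisets: they are to be compared up to permutation.
residues : (s t : ℕ) .{{_ : NonZero t}} → Partition → List ℕ
residues s t p = map (_%ℕ t) (sSet s p)

private
  part-antitone : ∀ p {i j} → i ≤ j → part p j ≤ part p i
  part-antitone p {i} {j} i≤j = go (ℕₚ.≤⇒≤′ i≤j)
    where
    go : ∀ {j} → i ℕ.≤′ j → part p j ≤ part p i
    go (ℕ.≤′-reflexive refl) = ℕₚ.≤-refl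
    go (ℕ.≤′-step le) = ℕₚ.≤-trans (decreasing p _) (go le)

  beta-strict : ∀ p {i j} → i < j → beta p j ℤ.< beta p i
  beta-strict p i<j =
    ℤₚ.+-mono-≤-< (ℤ.+≤+ (part-antitone p (ℕₚ.<⇒≤ i<j)))
                  (ℤₚ.neg-mono-< (ℤ.+<+ (s≤s i<j)))

  beta-injective : ∀ p {i j} → beta p i ≡ beta p j → i ≡ j
  beta-injective p {i} {j} eq with ℕₚ.<-cmp i j
  ... | tri< i<j _ _ = contradiction (sym eq) (ℤₚ.<⇒≢ (beta-strict p i<j))
  ... | tri≈ _ i≡j _ = i≡j
  ... | tri> _ _ j<i = contradiction eq (ℤₚ.<⇒≢ (beta-strict p j<i))

  shift-zero : ∀ k s → (+ 0 ℤ.- + suc (k ℕ.+ s)) ℤ.+ + s ≡ + 0 ℤ.- + suc k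
  shift-zero k s = begin
    ℤ.- + (suc k ℕ.+ s) ℤ.+ + s          ≡⟨ cong (ℤ._+ + s) (ℤₚ.neg-distrib-+ (+ suc k) (+ s)) ⟩
    ℤ.- + suc k ℤ.+ ℤ.- + s ℤ.+ + s      ≡⟨ ℤₚ.+-assoc (ℤ.- + suc k) (ℤ.- + s) (+ s) ⟩
    ℤ.- + suc k ℤ.+ (ℤ.- + s ℤ.+ + s)    ≡⟨ cong (λ z → ℤ.- + suc k ℤ.+ z) (ℤₚ.+-inverseˡ (+ s)) ⟩
    ℤ.- + suc k ℤ.+ + 0                  ≡⟨ ℤₚ.+-identityʳ _ ⟩
    ℤ.- + suc k                          ∎
    where open ≡-Reasoning

  beta-shift : ∀ s p i → bound p ℕ.+ s ≤ i → BetaSet p (beta p i ℤ.+ + s)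
  beta-shift s p i le = k , eq
    where
    k = i ℕ.∸ s
    k+s≡i : k ℕ.+ s ≡ i
    k+s≡i = ℕₚ.m∸n+n≡m (ℕₚ.≤-trans (ℕₚ.m≤n+m s (bound p)) le)
    b≤k : bound p ≤ k
    b≤k = ℕₚ.m+n≤o⇒m≤o∸n (bound p) le
    eq : beta p k ≡ beta p i ℤ.+ + s
    eq rewrite vanishes p i (ℕₚ.≤-trans (ℕₚ.m≤m+n _ s) le) | vanishes p k b≤k =
      sym (trans (cong (λ n → (+ 0 ℤ.- + suc n) ℤ.+ + s) (sym k+s≡i)) (shift-zero k s))

sSet-correct : ∀ s p x → x ∈ sSet s p ⇔ SSet s p x
sSet-correct s p x = mk⇔ to from
  where
  shifted : List ℤ
  shifted = map (λ i → beta p i ℤ.+ + s) (upTo (bound p ℕ.+ s))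
  to : x ∈ sSet s p → SSet s p x
  to x∈ with ∈-filter⁻ (λ x → ¬? (betaSet? p x)) {xs = shifted} x∈
  ... | x∈′ , x∉B with ∈-map⁻ (λ i → beta p i ℤ.+ + s) x∈′
  ... | i , _ , refl = (beta p i , (i , refl) , refl) , x∉B
  from : SSet s p x → x ∈ sSet s p
  from ((_ , (i , refl) , refl) , x∉B) with ℕₚ.<-≤-connex i (bound p ℕ.+ s)
  ... | inj₁ lt = ∈-filter⁺ (λ x → ¬? (betaSet? p x)) (∈-map⁺ (λ i → beta p i ℤ.+ + s) (∈-upTo⁺ lt)) x∉B
  ... | inj₂ ge = contradiction (beta-shift s p i ge) x∉B

sSet-unique : ∀ s p → Unique (sSet s p)
sSet-unique s p =
  Uniqueₚ.filter⁺ (λ x → ¬? (betaSet? p x))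
    (Uniqueₚ.map⁺ (λ {i} {j} eq → beta-injective p (+-cancelʳ (+ s) _ _ eq))
                  (Uniqueₚ.upTo⁺ (bound p ℕ.+ s)))

private
  -- Row i ≥ r keeps its cells j with j < c or (i+1, j+1) in the diagram.
  newRow : Partition → ℕ → ℕ → ℕ
  newRow p c i = part p i ⊓ (c ⊔ pred (part p (suc i)))

  removedPart : Partition → ℕ → ℕ → ℕ → ℕ
  removedPart p r c i with i ℕₚ.<? r
  ... | yes _ = part p i
  ... | no  _ = newRow p c i

  removedPart≤ : ∀ p r c i → removedPart p r c i ≤ part p i
  removedPart≤ p r c i with i ℕₚ.<? r
  ... | yes _ = ℕₚ.≤-refl
  ... | no  _ = ℕₚ.m⊓n≤m _ _

  removed : Partition → ℕ → ℕ → Partition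
  removed p r c .part = removedPart p r c
  removed p r c .decreasing i with suc i ℕₚ.<? r | i ℕₚ.<? r
  ... | yes _  | yes _  = decreasing p i
  ... | yes lt | no ¬lt = contradiction (ℕₚ.<-trans (ℕₚ.n<1+n i) lt) ¬lt
  ... | no _   | yes _  = ℕₚ.≤-trans (ℕₚ.m⊓n≤m _ _) (decreasing p i)
  ... | no _   | no _   =
    ℕₚ.⊓-mono-≤ (decreasing p i) (ℕₚ.⊔-monoʳ-≤ c (ℕₚ.pred-mono-≤ (decreasing p (suc i))))
  removed p r c .bound = bound p
  removed p r c .vanishes i le =
    ℕₚ.n≤0⇒n≡0 (subst (removedPart p r c i ≤_) (vanishes p i le) (removedPart≤ p r c i))

  <pred⇒ : ∀ {j n} → j < pred n → suc j < n
  <pred⇒ {n = suc n} lt = s≤s lt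

  ⇒<pred : ∀ {j n} → suc j < n → j < pred n
  ⇒<pred (s≤s lt) = lt

  removed-cells : ∀ p r c i j →
    Cell (removed p r c) i j ⇔ (Cell p i j × ¬ RimHook p r c i j)
  removed-cells p r c i j with i ℕₚ.<? r
  ... | yes i<r = mk⇔ (λ x → x , λ (_ , r≤i , _) → ℕₚ.<⇒≱ i<r r≤i) proj₁
  ... | no i≮r = mk⇔ to from
    where
    to : j < newRow p c i → Cell p i j × ¬ RimHook p r c i j
    to lt = ℕₚ.<-≤-trans lt (ℕₚ.m⊓n≤m _ _) , λ (_ , _ , c≤j , ∉p) →
      [ (λ m≡c → ℕₚ.<⇒≱ (subst (j <_) m≡c lt′) c≤j)
      , (λ m≡d → ∉p (<pred⇒ (subst (j <_) m≡d lt′)))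
      ]′ (ℕₚ.⊔-sel c (pred (part p (suc i))))
      where lt′ = ℕₚ.<-≤-trans lt (ℕₚ.m⊓n≤n (part p i) _)
    from : Cell p i j × ¬ RimHook p r c i j → j < newRow p c i
    from (lt , ∉R) = ℕₚ.⊓-glb lt below
      where
      below : j < c ⊔ pred (part p (suc i))
      below with j ℕₚ.<? c | suc j ℕₚ.<? part p (suc i)
      ... | yes j<c | _      = ℕₚ.<-≤-trans j<c (ℕₚ.m≤m⊔n c _)
      ... | no _    | yes ∈p = ℕₚ.<-≤-trans (⇒<pred ∈p) (ℕₚ.m≤n⊔m c _)
      ... | no j≮c  | no ∉p  =
        contradiction (lt , ℕₚ.≮⇒≥ i≮r , ℕₚ.≮⇒≥ j≮c , ∉p) ∉R

  removedPart< : ∀ p r c → Cell p r c → removedPart p r c r < part p r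
  removedPart< p r c c<p with r ℕₚ.<? r
  ... | yes r<r = contradiction r<r (ℕₚ.<-irrefl refl)
  ... | no _ = ℕₚ.≤-<-trans (ℕₚ.m⊓n≤n (part p r) _) (ℕₚ.⊔-lub c<p pred<)
    where
    pred< : pred (part p (suc r)) < part p r
    pred< with part p (suc r) | decreasing p r
    ... | zero  | _  = ℕₚ.≤-<-trans z≤n c<p
    ... | suc _ | le = le

  sumTo : (ℕ → ℕ) → ℕ → ℕ
  sumTo f zero    = 0
  sumTo f (suc n) = sumTo f n ℕ.+ f n

  sumTo-≤ : ∀ {f g} → (∀ i → f i ≤ g i) → ∀ n → sumTo f n ≤ sumTo g n
  sumTo-≤ f≤g zero    = z≤n
  sumTo-≤ f≤g (suc n) = ℕₚ.+-mono-≤ (sumTo-≤ f≤g n) (f≤g n)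

  sumTo-< : ∀ {f g} → (∀ i → f i ≤ g i) → ∀ {k} → f k < g k →
            ∀ n → k < n → sumTo f n < sumTo g n
  sumTo-< f≤g {k} fk<gk (suc n) k<1+n with ℕₚ.m≤n⇒m<n∨m≡n (ℕ.s≤s⁻¹ k<1+n)
  ... | inj₁ k<n  = ℕₚ.+-mono-<-≤ (sumTo-< f≤g fk<gk n k<n) (f≤g n)
  ... | inj₂ refl = ℕₚ.+-mono-≤-< (sumTo-≤ f≤g n) fk<gk

  size : Partition → ℕ
  size p = sumTo (part p) (bound p)

  cell⇒<bound : ∀ p {r c} → Cell p r c → r < bound p
  cell⇒<bound p {r} c<p with ℕₚ.<-≤-connex r (bound p)
  ... | inj₁ r<b = r<b
  ... | inj₂ b≤r = contradiction (subst (_ <_) (vanishes p r b≤r) c<p) λ ()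

  removed-smaller : ∀ p r c → Cell p r c → size (removed p r c) < size p
  removed-smaller p r c c<p =
    sumTo-< (removedPart≤ p r c) (removedPart< p r c c<p) (bound p) (cell⇒<bound p c<p)

  hook? : ∀ t p → Dec (∃[ r ] ∃[ c ] Cell p r c × hookLength p r c ≡ + t)
  hook? t p =
    map′ (λ (r , _ , c , x) → r , c , x)
         (λ (r , c , c<p , eq) → r , cell⇒<bound p c<p , c , c<p , eq)
         (ℕₚ.anyUpTo? (λ r → ℕₚ.anyUpTo? (λ c → hookLength p r c ℤₚ.≟ + t) (part p r)) (bound p))

core-exists : ∀ t p → ∃ (IsCoreOf t p)
core-exists t p = go p (<-wellFounded (size p))
  where
  go : ∀ p → Acc _<_ (size p) → ∃ (IsCoreOf t p)
  go p (acc rs) with hook? t p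
  ... | no none = p , ε , λ r c c<p eq → none (r , c , c<p , eq)
  ... | yes (r , c , c<p , eq) with go (removed p r c) (rs (removed-smaller p r c c<p))
  ...   | q , steps , q-core =
    q , (r , c , c<p , eq , removed-cells p r c) ◅ steps , q-core

module Submission where

-- Hooks of a partition are pairs (bead, lower gap) of its beta-set B: removing a rim hook of
-- length t moves one bead from x to x − t. Hence the numbers of beads in the residue classes
-- modulo t, counted above a low cutoff, survive the passage to the t-core and determine it.
-- For an s-core, B + s is the disjoint union of B and the s-set, so the residues of the s-set
-- record how those numbers change under translation by s. If they agree for two s-cores, the
-- difference of the two bead counts is the same for all residue classes because s generates ℤ/t,
-- and it is 0 because both partitions have equally many beads above the cutoff.

open import Defs
open import Data.Bool.Base using (if_then_else_; true; false)
open import Data.Integer.Base as ℤ using (ℤ; +_; 0ℤ; 1ℤ; ∣_∣; _+_; _-_; _*_; -_)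
open import Data.Integer.DivMod using (_%ℕ_; _/ℕ_; a≡a%ℕn+[a/ℕn]*n; n%ℕd<d)
import Data.Integer.Properties as ℤₚ
open import Data.Integer.Tactic.RingSolver using (solve-∀)
open import Data.List.Base using (List; []; _∷_; _++_; length; filter; map; upTo; applyUpTo; applyDownFrom)
open import Data.List.Membership.Propositional using (_∈_)
open import Data.List.Membership.Propositional.Properties
  using (∈-map⁺; ∈-map⁻; ∈-applyDownFrom⁺; ∈-applyDownFrom⁻; ∈-++⁺ˡ; ∈-++⁺ʳ; ∈-++⁻; ∈-∃++; ∈-filter⁺; ∈-filter⁻)
open import Data.List.Membership.Propositional.Properties.WithK using (unique∧set⇒bag)
open import Data.List.Properties using (map-∘; map-cong; map-++)
open import Data.List.Relation.Binary.BagAndSetEquality using (∼bag⇒↭)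
open import Data.List.Relation.Binary.Permutation.Propositional
  using (_↭_; ↭-refl; ↭-trans; ↭-reflexive; prep; swap; module PermutationReasoning)
open import Data.List.Relation.Binary.Permutation.Propositional.Properties
  using (map⁺; shift; ↭-length; ∈-resp-↭; ++-comm; drop-∷; ++⁺ˡ)
import Data.List.Relation.Unary.All as All
open import Data.List.Relation.Unary.AllPairs using ([]; _∷_)
open import Data.List.Relation.Unary.Any using (here; there)
open import Data.List.Relation.Unary.Unique.Propositional using (Unique)
import Data.List.Relation.Unary.Unique.Propositional.Properties as Uniqueₚ
open import Data.Nat.Base as ℕ using (ℕ; zero; suc; pred; NonZero; _≤_; _<_; z≤n; s≤s; _⊔_)
open import Data.Nat.Coprimality using (Coprime; coprime-Bézout)
open import Data.Nat.GCD using (module Bézout)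
open import Data.Nat.ListAction using (sum)
open import Data.Nat.ListAction.Properties using (sum-↭; sum-++)
import Data.Nat.Properties as ℕₚ
open import Data.Product.Base using (∃-syntax; _×_; _,_; proj₁; proj₂)
open import Data.Sum.Base using (_⊎_; inj₁; inj₂)
open import Function.Base using (_∘_; id)
open import Function.Bundles using (_⇔_; mk⇔; Equivalence)
open import Level using (0ℓ)
open import Relation.Binary.Construct.Closure.ReflexiveTransitive using (Star; ε; _◅_)
open import Relation.Binary.Definitions using (tri<; tri≈; tri>)
open import Relation.Binary.PropositionalEquality
open import Relation.Nullary using (¬_; yes; no; contradiction; does)
open import Relation.Unary using (Pred; Decidable)

open import Algebra.Properties.AbelianGroup ℤₚ.+-0-abelianGroup
  using () renaming (∙-cancelʳ to +-cancelʳ)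
open import Algebra.Properties.CommutativeSemigroup ℕₚ.+-commutativeSemigroup
  using (interchange; xy∙z≈xz∙y)
open Equivalence using (to; from)

-- Initial segments of the naturals and their cutoffs

infix 4 _HasCutoff_
_HasCutoff_ : Pred ℕ 0ℓ → ℕ → Set
P HasCutoff m = ∀ i → i < m ⇔ P i

cutoff-exists : ∀ {P : Pred ℕ 0ℓ} → Decidable P → (∀ {i j} → i ≤ j → P j → P i) →
                ∀ n → ¬ P n → ∃[ m ] P HasCutoff m
cutoff-exists P? down zero ¬P0 = 0 , λ i → mk⇔ (λ ()) (λ Pi → contradiction (down z≤n Pi) ¬P0)
cutoff-exists P? down (suc n) ¬Psn with P? n
... | no ¬Pn = cutoff-exists P? down n ¬Pn
... | yes Pn = suc n , λ i → mk⇔ (λ i<sn → down (ℕ.s≤s⁻¹ i<sn) Pn)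
  (λ Pi → ℕₚ.≰⇒> (λ sn≤i → ¬Psn (down sn≤i Pi)))

length-filter-upTo : ∀ {P : Pred ℕ 0ℓ} (P? : Decidable P) {m} → P HasCutoff m →
                     ∀ n → m ≤ n → length (filter P? (upTo n)) ≡ m
length-filter-upTo P? = go P? id
  where
  -- `upTo n` is `applyUpTo id n`, whose recursion replaces the function by its composite with
  -- `suc`; hence the induction is over a general `f`.
  go : ∀ {P : Pred ℕ 0ℓ} (P? : Decidable P) (f : ℕ → ℕ) {m} → (P ∘ f) HasCutoff m →
       ∀ n → m ≤ n → length (filter P? (applyUpTo f n)) ≡ m
  go P? f {zero}  cut zero    _    = refl
  go P? f {suc m} cut (suc n) (s≤s m≤n) with P? (f 0)
  ... | no ¬P0 = contradiction (to (cut 0) (s≤s z≤n)) ¬P0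
  ... | yes _  = cong suc (go P? (f ∘ suc)
    (λ i → mk⇔ (λ lt → to (cut (suc i)) (s≤s lt)) (ℕ.s≤s⁻¹ ∘ from (cut (suc i)))) n m≤n)
  go P? f {zero} cut (suc n) _ with P? (f 0)
  ... | yes P0 = contradiction (from (cut 0) P0) λ ()
  ... | no _   = go P? (f ∘ suc) (λ i → mk⇔ (λ ()) (λ Pi → contradiction (from (cut (suc i)) Pi) λ ())) n z≤n

-- Order of the beta-numbers

part-antitone : ∀ p {i j} → i ≤ j → part p j ≤ part p i
part-antitone p {i} i≤j = go (ℕₚ.≤⇒≤′ i≤j)
  where
  go : ∀ {j} → i ℕ.≤′ j → part p j ≤ part p i
  go (ℕ.≤′-reflexive refl) = ℕₚ.≤-refl
  go (ℕ.≤′-step le) = ℕₚ.≤-trans (decreasing p _) (go le)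

beta-strict : ∀ p {i j} → i < j → beta p j ℤ.< beta p i
beta-strict p i<j =
  ℤₚ.+-mono-≤-< (ℤ.+≤+ (part-antitone p (ℕₚ.<⇒≤ i<j))) (ℤₚ.neg-mono-< (ℤ.+<+ (s≤s i<j)))

beta-antitone : ∀ p {i j} → i ≤ j → beta p j ℤ.≤ beta p i
beta-antitone p i≤j =
  ℤₚ.+-mono-≤ (ℤ.+≤+ (part-antitone p i≤j)) (ℤₚ.neg-mono-≤ (ℤ.+≤+ (s≤s i≤j)))

beta-injective : ∀ p {i j} → beta p i ≡ beta p j → i ≡ j
beta-injective p {i} {j} eq with ℕₚ.<-cmp i j
... | tri< i<j _ _ = contradiction (sym eq) (ℤₚ.<⇒≢ (beta-strict p i<j))
... | tri≈ _ i≡j _ = i≡j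
... | tri> _ _ j<i = contradiction eq (ℤₚ.<⇒≢ (beta-strict p j<i))

beta-cancel-< : ∀ p {i j} → beta p j ℤ.< beta p i → i < j
beta-cancel-< p lt = ℕₚ.≰⇒> (λ j≤i → ℤₚ.<⇒≱ lt (beta-antitone p j≤i))

beta-beyond-bound : ∀ p {i} → bound p ≤ i → beta p i ≡ 0ℤ - + suc i
beta-beyond-bound p {i} b≤i rewrite vanishes p i b≤i = refl

beta-agree : ∀ p q {i} → bound p ≤ i → bound q ≤ i → beta p i ≡ beta q i
beta-agree p q p≤i q≤i = trans (beta-beyond-bound p p≤i) (sym (beta-beyond-bound q q≤i))

-- Column heights

cell⇒<bound : ∀ p {r c} → Cell p r c → r < bound p
cell⇒<bound p {r} c<p = ℕₚ.≰⇒> λ b≤r →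
  contradiction (subst (_ <_) (vanishes p r b≤r) c<p) λ ()

-- A column fills an initial segment of the rows, so its height can be read off from any cutoff
-- instead of the filtered list.
conjugate-unique : ∀ p {c m} → (λ i → Cell p i c) HasCutoff m → conjugate p c ≡ m
conjugate-unique p {c} {m} cut = length-filter-upTo (λ i → c ℕₚ.<? part p i) cut (bound p) m≤bound
  where
  m≤bound : m ≤ bound p
  m≤bound = ℕₚ.≮⇒≥ λ b<m → ℕₚ.<-irrefl refl (cell⇒<bound p (to (cut (bound p)) b<m))

conjugate-cutoff : ∀ p c → (λ i → Cell p i c) HasCutoff conjugate p c
conjugate-cutoff p c with cutoff-exists (λ i → c ℕₚ.<? part p i)
    (λ i≤j lt → ℕₚ.<-≤-trans lt (part-antitone p i≤j))
    (bound p) (ℕₚ.<-irrefl refl ∘ cell⇒<bound p)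
... | m , cut = subst ((λ i → Cell p i c) HasCutoff_) (sym (conjugate-unique p cut)) cut

-- Hooks as pairs of a bead and a lower gap

-+-cancel : ∀ x y → x - y + y ≡ x
-+-cancel = solve-∀

-- With m the number of beads above the gap y, the rim hook of (r , y + m) moves the bead β_r to y.
gap⇒hook : ∀ p r y → y ℤ.< beta p r → ¬ BetaSet p y → ∃[ c ] Cell p r c × hookLength p r c ≡ beta p r - y
gap⇒hook p r y y<βr y∉B with cutoff-exists (λ i → y ℤₚ.<? beta p i)
                   (λ i≤j lt → ℤₚ.<-≤-trans lt (beta-antitone p i≤j)) far ¬y<far
  where
  -- From index `bound p` on, bead `i` is -1 - i, so at this index the beads have dropped to `y` or
  -- below.
  far = bound p ℕ.+ ∣ y ∣
  -suc≤ : ∀ z n → ∣ z ∣ ≤ n → 0ℤ - + suc n ℤ.≤ z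
  -suc≤ (+ _) n _ = ℤ.-≤+
  -suc≤ ℤ.-[1+ k ] n le = ℤ.-≤- (ℕₚ.<⇒≤ le)
  ¬y<far : ¬ (y ℤ.< beta p far)
  ¬y<far lt = ℤₚ.<⇒≱ lt (subst (ℤ._≤ y) (sym (beta-beyond-bound p (ℕₚ.m≤m+n (bound p) ∣ y ∣)))
    (-suc≤ y far (ℕₚ.m≤n+m ∣ y ∣ (bound p))))
... | m , cut = c , to (rows r) r<m , hook
  where
  r<m : r < m
  r<m = from (cut r) y<βr
  βm<y : beta p m ℤ.< y
  βm<y = ℤₚ.≤∧≢⇒< (ℤₚ.≮⇒≥ (ℕₚ.<-irrefl refl ∘ from (cut m))) (λ eq → y∉B (m , eq))
  pm≤y+m : + part p m ℤ.≤ y + + m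
  pm≤y+m = subst (ℤ._≤ y + + m) (cancel (+ part p m) (+ m)) (ℤₚ.+-monoˡ-≤ (+ m) (ℤₚ.i<j⇒suc[i]≤j βm<y))
    where
    cancel : ∀ a b → 1ℤ + (a - (1ℤ + b)) + b ≡ a
    cancel = solve-∀
  -- By `pm≤y+m` the integer `y + m` is nonnegative, so taking its absolute value changes nothing.
  -- Column `c` has height exactly `m`, because row `m` has length at most `c` while the rows before
  -- it are longer than `c`.
  c : ℕ
  c = ∣ y + + m ∣
  c≡ : + c ≡ y + + m
  c≡ = ℤₚ.0≤i⇒+∣i∣≡i (ℤₚ.≤-trans (ℤ.+≤+ z≤n) pm≤y+m)
  -- Used with `n = m`: the bead of index `m − 1` is the lowest one above `y`, and earlier rows are
  -- at least as long as row `m − 1`.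
  row-above : ∀ {i} n → i < n → y ℤ.< beta p (pred n) → y + + n ℤ.< + part p i
  row-above (suc n) (s≤s i≤n) lt = ℤₚ.<-≤-trans
    (subst (y + + suc n ℤ.<_) (-+-cancel (+ part p n) (+ suc n)) (ℤₚ.+-monoˡ-< (+ suc n) lt))
    (ℤ.+≤+ (part-antitone p i≤n))
  rows : (λ i → Cell p i c) HasCutoff m
  rows i = mk⇔
    (λ i<m → ℤₚ.drop‿+<+ (subst (ℤ._< + part p i) (sym c≡)
      (row-above m i<m (to (cut (pred m)) (pred< i<m)))))
    (λ c<pi → ℕₚ.≰⇒> λ m≤i → ℕₚ.<⇒≱ c<pi
      (ℕₚ.≤-trans (part-antitone p m≤i) (ℤₚ.drop‿+≤+ (subst (+ part p m ℤ.≤_) (sym c≡) pm≤y+m))))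
    where
    pred< : ∀ {i n} → i < n → pred n < n
    pred< {n = suc _} _ = ℕₚ.≤-refl
  hook : hookLength p r c ≡ beta p r - y
  hook = begin
    1ℤ + beta p r + (+ conjugate p c - (1ℤ + + c))
      ≡⟨ cong₂ (λ k l → 1ℤ + beta p r + (+ k - (1ℤ + l))) (conjugate-unique p rows) c≡ ⟩
    1ℤ + beta p r + (+ m - (1ℤ + (y + + m)))
      ≡⟨ cancel (beta p r) y (+ m) ⟩
    beta p r - y ∎
    where
    open ≡-Reasoning
    cancel : ∀ b y m → 1ℤ + b + (m - (1ℤ + (y + m))) ≡ b - y
    cancel = solve-∀

-- A gap at `x − s` below a bead `x` would give a hook of length `s` by `gap⇒hook`.
core⇒beta-shift : ∀ {s} .{{_ : NonZero s}} p → IsCore s p → ∀ x → BetaSet p x → BetaSet p (x - + s)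
core⇒beta-shift {s@(suc _)} p core _ (r , refl) with betaSet? p (beta p r - + s)
... | yes y∈B = y∈B
... | no y∉B =
  let c , c<pr , hook = gap⇒hook p r _ y<βr y∉B
  in contradiction (trans hook (cancel (beta p r) (+ s))) (core r c c<pr)
  where
  y<βr : beta p r - + s ℤ.< beta p r
  y<βr = subst (beta p r - + s ℤ.<_) (ℤₚ.+-identityʳ _) (ℤₚ.+-monoʳ-< (beta p r) ℤ.-<+)
  cancel : ∀ b s → b - (b - s) ≡ s
  cancel = solve-∀

-- Effect of a rim hook removal on the beads

-- Periodic functions stand for functions on ℤ/t, so no quotient has to be formed.
Periodic : ∀ {A : Set} → ℕ → (ℤ → A) → Set
Periodic t f = ∀ x → f (x + + t) ≡ f x

-- The `n` largest beads, listed upwards so that raising `n` by one only adds a head.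
betas : Partition → ℕ → List ℤ
betas p = applyDownFrom (beta p)

-- Turns the description of a diagram by its cells into equations between row lengths.
<-extensional : ∀ {a b} → (∀ j → j < a ⇔ j < b) → a ≡ b
<-extensional {a} {b} eq = ℕₚ.≤-antisym
  (ℕₚ.≮⇒≥ λ b<a → ℕₚ.<-irrefl refl (to (eq b) b<a))
  (ℕₚ.≮⇒≥ λ a<b → ℕₚ.<-irrefl refl (from (eq a) a<b))

module _ {t p q} (step : RemoveHook t p q) where
  private
    r = proj₁ step
    c = proj₁ (proj₂ step)
    c<pr : Cell p r c
    c<pr = proj₁ (proj₂ (proj₂ step))
    hook : hookLength p r c ≡ + t
    hook = proj₁ (proj₂ (proj₂ (proj₂ step)))
    cells : ∀ i j → Cell q i j ⇔ (Cell p i j × ¬ RimHook p r c i j)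
    cells = proj₂ (proj₂ (proj₂ (proj₂ step)))
    m = conjugate p c
    cut : (λ i → Cell p i c) HasCutoff m
    cut = conjugate-cutoff p c

    -- The rim hook meets only the rows from `r` to `m − 1`, where `m` is the height of column `c`.
    row-outside : ∀ i → (i < r ⊎ m ≤ i) → part q i ≡ part p i
    row-outside i outside = <-extensional λ j → mk⇔ (proj₁ ∘ to (cells i j))
      (λ j<pi → from (cells i j) (j<pi , λ (_ , r≤i , c≤j , _) → case-outside j<pi r≤i c≤j outside))
      where
      case-outside : ∀ {j} → j < part p i → r ≤ i → c ≤ j → ¬ (i < r ⊎ m ≤ i)
      case-outside _ r≤i _ (inj₁ i<r) = ℕₚ.<⇒≱ i<r r≤i
      case-outside j<pi _ c≤j (inj₂ m≤i) = ℕₚ.<⇒≱ (from (cut i) (ℕₚ.≤-<-trans c≤j j<pi)) m≤i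

    -- The surviving cells (i, j) are exactly those with (i + 1, j + 1) in the diagram; the cells
    -- left of column `c` are among them because row `i + 1` reaches past column `c`.
    row-inside : ∀ i → r ≤ i → suc i < m → suc (part q i) ≡ part p (suc i)
    row-inside i r≤i si<m = <-extensional λ where
        zero → mk⇔ (λ _ → ℕₚ.≤-<-trans z≤n c<psi) (λ _ → s≤s z≤n)
        (suc j) → mk⇔ (λ lt → fwd (to (cells i j) (ℕ.s≤s⁻¹ lt)))
          (λ lt → s≤s (from (cells i j)
            (ℕₚ.<-≤-trans (ℕₚ.<-trans (ℕₚ.n<1+n j) lt) (decreasing p i) , λ (_ , _ , _ , ∉p) → ∉p lt)))
      where
      c<psi : c < part p (suc i)
      c<psi = to (cut (suc i)) si<m
      fwd : ∀ {j} → Cell p i j × ¬ RimHook p r c i j → suc j < part p (suc i)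
      fwd {j} (j<pi , ∉R) with suc j ℕₚ.<? part p (suc i)
      ... | yes lt = lt
      ... | no ≮ = contradiction
        (j<pi , r≤i , ℕ.s≤s⁻¹ (ℕₚ.<-≤-trans c<psi (ℕₚ.≮⇒≥ ≮)) , ≮) ∉R

    -- Row `m` has length at most `c`, so every cell of row `m − 1` from column `c` on lies on the
    -- rim and is removed.
    row-last : ∀ i → r ≤ i → suc i ≡ m → part q i ≡ c
    row-last i r≤i si≡m = <-extensional λ j → mk⇔ (λ j<qi → fwd (to (cells i j) j<qi))
      (λ j<c → from (cells i j) (ℕₚ.<-trans j<c (to (cut i) (ℕₚ.≤-reflexive si≡m)) ,
        λ (_ , _ , c≤j , _) → ℕₚ.<⇒≱ j<c c≤j))
      where
      psi≤c : part p (suc i) ≤ c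
      psi≤c = ℕₚ.≮⇒≥ λ lt → ℕₚ.<-irrefl si≡m (from (cut (suc i)) lt)
      fwd : ∀ {j} → Cell p i j × ¬ RimHook p r c i j → j < c
      fwd {j} (j<pi , ∉R) = ℕₚ.≰⇒> λ c≤j →
        ∉R (j<pi , r≤i , c≤j , λ lt → ℕₚ.<⇒≱ lt (ℕₚ.≤-trans psi≤c (ℕₚ.m≤n⇒m≤1+n c≤j)))

    beta-outside : ∀ i → (i < r ⊎ m ≤ i) → beta q i ≡ beta p i
    beta-outside i outside = cong (λ n → + n - + suc i) (row-outside i outside)

    beta-inside : ∀ i → r ≤ i → suc i < m → beta q i ≡ beta p (suc i)
    beta-inside i r≤i si<m rewrite sym (row-inside i r≤i si<m) = cancel (+ part q i) (+ i)
      where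
      cancel : ∀ a b → a - (1ℤ + b) ≡ (1ℤ + a) - (1ℤ + (1ℤ + b))
      cancel = solve-∀

    -- The new bead is `c − m`, and the hook length formula says that `t` is its distance to the
    -- bead of row `r`.
    beta-last : ∀ i → r ≤ i → suc i ≡ m → beta q i + + t ≡ beta p r
    beta-last i r≤i si≡m = begin
      + part q i - + suc i + + t
        ≡⟨ cong₂ (λ a b → + a - b + + t) (row-last i r≤i si≡m) (cong +_ si≡m) ⟩
      + c - + m + + t
        ≡⟨ cong (λ h → + c - + m + h) hook ⟨
      + c - + m + (1ℤ + beta p r + (+ m - (1ℤ + + c)))
        ≡⟨ cancel (+ c) (+ m) (beta p r) ⟩
      beta p r ∎
      where
      open ≡-Reasoning
      cancel : ∀ c m b → c - m + (1ℤ + b + (m - (1ℤ + c))) ≡ b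
      cancel = solve-∀

    module _ {A : Set} {f : ℤ → A} (periodic : Periodic t f) where
      fs : Partition → ℕ → List A
      fs x n = map f (betas x n)

      before : ∀ n → n ≤ r → fs q n ≡ fs p n
      before zero    _   = refl
      before (suc n) n<r = cong₂ _∷_ (cong f (beta-outside n (inj₁ n<r))) (before n (ℕₚ.<⇒≤ n<r))

      -- The beads r + 1 , … , m − 1 of p are the beads r , … , m − 2 of q.
      during : ∀ k → r ≤ k → k < m → f (beta p r) ∷ fs q k ↭ fs p (suc k)
      during k r≤k k<m with ℕₚ.m≤n⇒m<n∨m≡n r≤k
      during k _ _ | inj₂ refl = ↭-reflexive (cong (f (beta p r) ∷_) (before r ℕₚ.≤-refl))
      during (suc k) _ k<m | inj₁ (s≤s r≤k) = begin
        f (beta p r) ∷ f (beta q k) ∷ fs q k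
          ↭⟨ swap _ _ ↭-refl ⟩
        f (beta q k) ∷ f (beta p r) ∷ fs q k
          ≡⟨ cong (λ x → f x ∷ f (beta p r) ∷ fs q k) (beta-inside k r≤k k<m) ⟩
        f (beta p (suc k)) ∷ f (beta p r) ∷ fs q k
          ↭⟨ prep _ (during k r≤k (ℕₚ.<-trans (ℕₚ.n<1+n k) k<m)) ⟩
        fs p (suc (suc k)) ∎
        where open PermutationReasoning

      after : ∀ n → m ≤ n → fs q n ↭ fs p n
      after n m≤n with ℕₚ.m≤n⇒m<n∨m≡n m≤n
      after (suc n) _ | inj₁ (s≤s m≤n) = begin
        f (beta q n) ∷ fs q n ≡⟨ cong (λ x → f x ∷ fs q n) (beta-outside n (inj₂ m≤n)) ⟩
        f (beta p n) ∷ fs q n ↭⟨ prep _ (after n m≤n) ⟩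
        f (beta p n) ∷ fs p n ∎
        where open PermutationReasoning
      after zero _ | inj₂ m≡0 = ↭-refl
      after (suc n) _ | inj₂ m≡sn = begin
        -- Here periodicity enters: `f` does not distinguish the moved bead from the original bead
        -- of row `r`.
        f (beta q n) ∷ fs q n        ≡⟨ cong (_∷ fs q n) (periodic (beta q n)) ⟨
        f (beta q n + + t) ∷ fs q n  ≡⟨ cong (λ x → f x ∷ fs q n) (beta-last n r≤n (sym m≡sn)) ⟩
        f (beta p r) ∷ fs q n        ↭⟨ during n r≤n (ℕₚ.≤-reflexive (sym m≡sn)) ⟩
        fs p (suc n)                 ∎
        where
        open PermutationReasoning
        r≤n : r ≤ n
        r≤n = ℕ.s≤s⁻¹ (subst (r <_) m≡sn (from (cut r) c<pr))

  -- One bead drops by `t` and the others are at most reindexed. All affected rows lie before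
  -- `bound p`, so the truncation contains them.
  removeHook-betas : ∀ {A : Set} {f : ℤ → A} → Periodic t f →
    ∀ n → bound p ≤ n → map f (betas q n) ↭ map f (betas p n)
  removeHook-betas periodic n b≤n = after periodic n (ℕₚ.≤-trans m≤b b≤n)
    where
    m≤b : m ≤ bound p
    m≤b = ℕₚ.≮⇒≥ λ b<m → ℕₚ.<-irrefl refl (cell⇒<bound p (to (cut (bound p)) b<m))

-- The bounds of successive partitions are unrelated, so `N` is the maximum of the bounds along the
-- whole chain.
coreOf-betas : ∀ {t p q} → Star (RemoveHook t) p q → ∀ {A : Set} {f : ℤ → A} → Periodic t f →
  ∃[ N ] bound p ≤ N × bound q ≤ N × (∀ n → N ≤ n → map f (betas q n) ↭ map f (betas p n))
coreOf-betas {p = p} ε periodic = bound p , ℕₚ.≤-refl , ℕₚ.≤-refl , λ _ _ → ↭-refl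
coreOf-betas {t} {p} (_◅_ {j = q} step steps) periodic =
  let N , _ , r≤N , rest = coreOf-betas steps periodic in
  bound p ℕ.⊔ N , ℕₚ.m≤m⊔n _ _ , ℕₚ.≤-trans r≤N (ℕₚ.m≤n⊔m (bound p) N) ,
  λ n le → ↭-trans (rest n (ℕₚ.m⊔n≤o⇒n≤o _ _ le))
    (removeHook-betas {t} {p} {q} step periodic n (ℕₚ.m⊔n≤o⇒m≤o _ _ le))

-- The `s`-set and truncated lists of beads

-- Beyond the bound the beads are consecutive integers.
beta-shift : ∀ s p {k} → bound p ≤ k → beta p (s ℕ.+ k) + + s ≡ beta p k
beta-shift s p {k} b≤k
  rewrite vanishes p k b≤k | vanishes p (s ℕ.+ k) (ℕₚ.≤-trans b≤k (ℕₚ.m≤n+m k s)) = cancel (+ s) (+ k)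
  where
  cancel : ∀ s k → 0ℤ - (1ℤ + (s + k)) + s ≡ 0ℤ - (1ℤ + k)
  cancel = solve-∀

betas-unique : ∀ p n → Unique (betas p n)
betas-unique p n = Uniqueₚ.applyDownFrom⁺₁ (beta p) n
  (λ j<i _ eq → ℕₚ.<⇒≢ j<i (sym (beta-injective p eq)))

-- The disjoint union S ∪ B equals B + s because B ⊆ B + s for an s-core.
sSet-betas : ∀ {s} .{{_ : NonZero s}} p → IsCore s p → ∀ n → bound p ≤ n →
  sSet s p ++ betas p n ↭ map (_+ + s) (betas p (s ℕ.+ n))
sSet-betas {s} p core n b≤n = ∼bag⇒↭ (unique∧set⇒bag
  (Uniqueₚ.++⁺ (sSet-unique s p) (betas-unique p n) disjoint)
  (Uniqueₚ.map⁺ (+-cancelʳ (+ s) _ _) (betas-unique p (s ℕ.+ n)))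
  (mk⇔ fwd bwd))
  where
  disjoint : ∀ {x} → ¬ (x ∈ sSet s p × x ∈ betas p n)
  disjoint (x∈S , x∈B) with ∈-applyDownFrom⁻ (beta p) x∈B
  ... | j , _ , x≡ = proj₂ (to (sSet-correct s p _) x∈S) (j , sym x≡)
  beyond : ∀ {i} → s ℕ.+ n ≤ i → ∃[ k ] n ≤ k × beta p i + + s ≡ beta p k
  beyond {i} le = i ℕ.∸ s , n≤k , trans (cong (λ i → beta p i + + s) (sym s+k≡i)) (beta-shift s p (ℕₚ.≤-trans b≤n n≤k))
    where
    n≤k : n ≤ i ℕ.∸ s
    n≤k = ℕₚ.m+n≤o⇒m≤o∸n n (subst (_≤ i) (ℕₚ.+-comm s n) le)
    s+k≡i : s ℕ.+ (i ℕ.∸ s) ≡ i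
    s+k≡i = ℕₚ.m+[n∸m]≡n (ℕₚ.≤-trans (ℕₚ.m≤m+n s n) le)
  -- A bead of index `s + n` or more would be shifted onto a bead of index at least `n`; excluding
  -- this puts the index `i` inside the truncation.
  shifted : ∀ i → (∀ {k} → n ≤ k → beta p i + + s ≢ beta p k) →
            beta p i + + s ∈ map (_+ + s) (betas p (s ℕ.+ n))
  shifted i inside = ∈-map⁺ (_+ + s) (∈-applyDownFrom⁺ (beta p) (ℕₚ.≰⇒> λ le →
    let _ , n≤k , eq = beyond le in inside n≤k eq))
  fwd : ∀ {x} → x ∈ sSet s p ++ betas p n → x ∈ map (_+ + s) (betas p (s ℕ.+ n))
  fwd x∈ with ∈-++⁻ (sSet s p) x∈
  ... | inj₁ x∈S with to (sSet-correct s p _) x∈S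
  ...   | (_ , (i , refl) , refl) , x∉B = shifted i λ _ eq → x∉B (_ , sym eq)
  fwd x∈ | inj₂ x∈B with ∈-applyDownFrom⁻ (beta p) x∈B
  ...   | j , j<n , refl with core⇒beta-shift p core _ (j , refl)
  ...     | i , eq = subst (_∈ map (_+ + s) (betas p (s ℕ.+ n))) i+s≡j
    (shifted i λ n≤k eq′ → ℕₚ.<⇒≱ j<n (subst (n ≤_) (beta-injective p (trans (sym eq′) i+s≡j)) n≤k))
    where
    i+s≡j : beta p i + + s ≡ beta p j
    i+s≡j = trans (cong (_+ + s) eq) (-+-cancel (beta p j) (+ s))
  bwd : ∀ {x} → x ∈ map (_+ + s) (betas p (s ℕ.+ n)) → x ∈ sSet s p ++ betas p n
  bwd x∈ with ∈-map⁻ (_+ + s) x∈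
  ... | _ , y∈ , refl with ∈-applyDownFrom⁻ (beta p) y∈
  ...   | i , i<s+n , refl with betaSet? p (beta p i + + s)
  ...     | no x∉B = ∈-++⁺ˡ (from (sSet-correct s p _) ((_ , (i , refl) , refl) , x∉B))
  ...     | yes (j , eq) = ∈-++⁺ʳ (sSet s p) (subst (_∈ betas p n) eq (∈-applyDownFrom⁺ (beta p) j<n))
    where
    -- If `n ≤ j`, then `i = s + j` by injectivity of `beta`, against `i < s + n`.
    j<n : j < n
    j<n = ℕₚ.≰⇒> λ n≤j → ℕₚ.<⇒≱ i<s+n (subst (s ℕ.+ n ≤_)
      (beta-injective p (+-cancelʳ (+ s) _ _ (trans (beta-shift s p (ℕₚ.≤-trans b≤n n≤j)) eq)))
      (ℕₚ.+-monoʳ-≤ s n≤j))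

-- Functions on the residues modulo `t`

periodic-* : ∀ {A : Set} {t} {f : ℤ → A} → Periodic t f → ∀ x k → f (x + k * + t) ≡ f x
periodic-* {t = t} {f} periodic = ints
  where
  nats : ∀ x k → f (x + + k * + t) ≡ f x
  nats x zero = cong f (ℤₚ.+-identityʳ x)
  nats x (suc k) = begin
    f (x + (1ℤ + + k) * + t) ≡⟨ cong f (step x (+ k) (+ t)) ⟩
    f (x + + k * + t + + t)  ≡⟨ periodic _ ⟩
    f (x + + k * + t)        ≡⟨ nats x k ⟩
    f x                      ∎
    where
    open ≡-Reasoning
    step : ∀ x k t → x + (1ℤ + k) * t ≡ x + k * t + t
    step = solve-∀
  ints : ∀ x k → f (x + k * + t) ≡ f x
  ints x (+ k) = nats x k
  ints x k@(ℤ.-[1+ n ]) = begin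
    f (x + k * + t)                     ≡⟨ nats (x + k * + t) (suc n) ⟨
    f (x + k * + t + + suc n * + t)     ≡⟨ cong f (cancel x (+ suc n) (+ t)) ⟩
    f x                                 ∎
    where
    open ≡-Reasoning
    cancel : ∀ x k t → x + (- k) * t + k * t ≡ x
    cancel = solve-∀

periodic-shift : ∀ {A : Set} {t} {f : ℤ → A} → Periodic t f → ∀ d → Periodic t (f ∘ (_+ d))
periodic-shift {t = t} {f} periodic d x = trans (cong f (comm x (+ t) d)) (periodic (x + d))
  where
  comm : ∀ x t d → x + t + d ≡ x + d + t
  comm = solve-∀

module _ (t : ℕ) .{{_ : NonZero t}} where

  periodic-% : ∀ {A : Set} {f : ℤ → A} → Periodic t f → ∀ x → f x ≡ f (+ (x %ℕ t))
  periodic-% {f = f} periodic x =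
    trans (cong f (a≡a%ℕn+[a/ℕn]*n x t)) (periodic-* periodic (+ (x %ℕ t)) (x /ℕ t))

  private
    -- A positive `k` would force `b` to be at least `t`; a negative `k` is reduced to this by
    -- exchanging `a` and `b`.
    remainder-unique : ∀ {a b} k → a < t → b < t → + a + k * + t ≡ + b → a ≡ b
    remainder-unique {a} (+ zero) _ _ eq = ℤₚ.+-injective (trans (sym (ℤₚ.+-identityʳ (+ a))) eq)
    remainder-unique {a} {b} (+ suc k) _ b<t eq = contradiction b<t (ℕₚ.≤⇒≯ (begin
      t                       ≤⟨ ℕₚ.m≤m+n t (k ℕ.* t) ⟩
      suc k ℕ.* t             ≤⟨ ℕₚ.m≤n+m _ a ⟩
      a ℕ.+ suc k ℕ.* t       ≡⟨ ℤₚ.+-injective (trans (cong (λ z → + a + z) (ℤₚ.pos-* (suc k) t)) eq) ⟩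
      b                       ∎))
      where open ℕₚ.≤-Reasoning
    remainder-unique {a} {b} ℤ.-[1+ k ] a<t b<t eq =
      sym (remainder-unique (+ suc k) b<t a<t (trans (cong (_+ + suc k * + t) (sym eq)) (cancel (+ a) (+ suc k) (+ t))))
      where
      cancel : ∀ x k t → x + (- k) * t + k * t ≡ x
      cancel = solve-∀

  %-periodic : Periodic t (_%ℕ t)
  -- The multiplier is the discrepancy between the quotient of `x + t` and the quotient of `x` plus
  -- one; it need not be known to vanish.
  %-periodic x = remainder-unique (y /ℕ t - (x /ℕ t + 1ℤ)) (n%ℕd<d y t) (n%ℕd<d x t) (begin
    + (y %ℕ t) + (y /ℕ t - (x /ℕ t + 1ℤ)) * + t
      ≡⟨ regroup (+ (y %ℕ t)) (y /ℕ t) (x /ℕ t) (+ t) ⟩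
    + (y %ℕ t) + y /ℕ t * + t - (x /ℕ t * + t + + t)
      ≡⟨ cong (_- (x /ℕ t * + t + + t)) (a≡a%ℕn+[a/ℕn]*n y t) ⟨
    x + + t - (x /ℕ t * + t + + t)
      ≡⟨ cong (λ x′ → x′ + + t - (x /ℕ t * + t + + t)) (a≡a%ℕn+[a/ℕn]*n x t) ⟩
    + (x %ℕ t) + x /ℕ t * + t + + t - (x /ℕ t * + t + + t)
      ≡⟨ cancel (+ (x %ℕ t)) (x /ℕ t * + t) (+ t) ⟩
    + (x %ℕ t) ∎)
    where
    y = x + + t
    open ≡-Reasoning
    regroup : ∀ r a b t → r + (a - (b + 1ℤ)) * t ≡ r + a * t - (b * t + t)
    regroup = solve-∀
    cancel : ∀ r a t → r + a + t - (a + t) ≡ r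
    cancel = solve-∀

  -- A periodic function factors through the residue.
  ↭-periodic : ∀ {A : Set} {f : ℤ → A} → Periodic t f → ∀ {xs ys} →
    map (_%ℕ t) xs ↭ map (_%ℕ t) ys → map f xs ↭ map f ys
  ↭-periodic {f = f} periodic {xs} {ys} perm = begin
    map f xs                         ≡⟨ factor xs ⟩
    map (f ∘ +_) (map (_%ℕ t) xs)    ↭⟨ map⁺ (f ∘ +_) perm ⟩
    map (f ∘ +_) (map (_%ℕ t) ys)    ≡⟨ factor ys ⟨
    map f ys                         ∎
    where
    open PermutationReasoning
    factor : ∀ xs → map f xs ≡ map (f ∘ +_) (map (_%ℕ t) xs)
    factor xs = trans (map-cong (periodic-% periodic) xs) (map-∘ xs)

-- Weighted bead counts and their translation invariance

-- With `w` the indicator of a residue class this counts the beads in that class.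
weigh : (ℤ → ℕ) → Partition → ℕ → ℕ
weigh w p n = sum (map w (betas p n))

weigh-+ : ∀ w w′ p n → weigh (λ x → w x ℕ.+ w′ x) p n ≡ weigh w p n ℕ.+ weigh w′ p n
weigh-+ w w′ p zero = refl
weigh-+ w w′ p (suc n) = trans (cong (w x ℕ.+ w′ x ℕ.+_) (weigh-+ w w′ p n))
  (interchange (w x) (w′ x) (weigh w p n) (weigh w′ p n))
  where
  x = beta p n

weigh-const : ∀ c p q n → weigh (λ _ → c) p n ≡ weigh (λ _ → c) q n
weigh-const c p q zero = refl
weigh-const c p q (suc n) = cong (c ℕ.+_) (weigh-const c p q n)

module _ (p q : Partition) where

  excess : ℕ → (ℤ → ℕ) → ℤ
  excess n w = + weigh w p n - + weigh w q n

  excess-cong : ∀ n {w w′} → w ≗ w′ → excess n w ≡ excess n w′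
  excess-cong n eq = cong₂ (λ a b → + sum a - + sum b) (map-cong eq (betas p n)) (map-cong eq (betas q n))

  excess-+ : ∀ n w w′ → excess n (λ x → w x ℕ.+ w′ x) ≡ excess n w + excess n w′
  excess-+ n w w′ = trans (cong₂ (λ a b → + a - + b) (weigh-+ w w′ p n) (weigh-+ w w′ q n))
    (regroup (+ weigh w p n) (+ weigh w′ p n) (+ weigh w q n) (+ weigh w′ q n))
    where
    regroup : ∀ a b c d → a + b - (c + d) ≡ a - c + (b - d)
    regroup = solve-∀

  module _ {n} (p≤n : bound p ≤ n) (q≤n : bound q ≤ n) where

    -- Beyond both bounds the beads of `p` and `q` coincide and their contributions cancel.
    excess-stable : ∀ k w → excess (k ℕ.+ n) w ≡ excess n w
    excess-stable zero    w = refl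
    excess-stable (suc k) w = begin
      + (w (beta p i) ℕ.+ weigh w p i) - + (w (beta q i) ℕ.+ weigh w q i)
        ≡⟨ cong (λ x → + (w x ℕ.+ weigh w p i) - + (w (beta q i) ℕ.+ weigh w q i)) βp≡βq ⟩
      + (w (beta q i) ℕ.+ weigh w p i) - + (w (beta q i) ℕ.+ weigh w q i)
        ≡⟨ cancel (+ w (beta q i)) (+ weigh w p i) (+ weigh w q i) ⟩
      excess i w
        ≡⟨ excess-stable k w ⟩
      excess n w ∎
      where
      open ≡-Reasoning
      i = k ℕ.+ n
      βp≡βq : beta p i ≡ beta q i
      βp≡βq = beta-agree p q (ℕₚ.≤-trans p≤n (ℕₚ.m≤n+m n k)) (ℕₚ.≤-trans q≤n (ℕₚ.m≤n+m n k))
      cancel : ∀ a b c → a + b - (a + c) ≡ b - c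
      cancel = solve-∀

    module _ {s t} .{{_ : NonZero s}} .{{_ : NonZero t}} (coprime : Coprime s t)
             (p-core : IsCore s p) (q-core : IsCore s q)
             (perm : residues s t p ↭ residues s t q) where

      -- Quantifying over all periodic `w` lets translations be composed, since translates of
      -- periodic functions are periodic.
      Invariant : ℤ → Set
      Invariant d = ∀ {w} → Periodic t w → excess n (w ∘ (_+ d)) ≡ excess n w

      -- By `sSet-betas` translation by `s` adds the weight of the `s`-set, which is the same for
      -- `p` and `q` by `perm` and cancels in the difference.
      invariant-s : Invariant (+ s)
      invariant-s {w} periodic = begin
        -- `sSet-betas` involves `s + n` shifted beads, so the truncation is lengthened first.
        excess n (w ∘ (_+ + s))                   ≡⟨ excess-stable s (w ∘ (_+ + s)) ⟨
        excess (s ℕ.+ n) (w ∘ (_+ + s))           ≡⟨ cong₂ (λ a b → + a - + b) (split p p-core p≤n) (split q q-core q≤n) ⟨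
        + (sum (map w (sSet s p)) ℕ.+ weigh w p n) - + (sum (map w (sSet s q)) ℕ.+ weigh w q n)
          ≡⟨ cong (λ a → + (a ℕ.+ weigh w p n) - + (sum (map w (sSet s q)) ℕ.+ weigh w q n))
               (sum-↭ (↭-periodic t periodic {sSet s p} {sSet s q} perm)) ⟩
        + (sum (map w (sSet s q)) ℕ.+ weigh w p n) - + (sum (map w (sSet s q)) ℕ.+ weigh w q n)
          ≡⟨ cancel (+ sum (map w (sSet s q))) (+ weigh w p n) (+ weigh w q n) ⟩
        excess n w                               ∎
        where
        open ≡-Reasoning
        cancel : ∀ a b c → a + b - (a + c) ≡ b - c
        cancel = solve-∀
        split : ∀ x → IsCore s x → bound x ≤ n →
          sum (map w (sSet s x)) ℕ.+ weigh w x n ≡ weigh (w ∘ (_+ + s)) x (s ℕ.+ n)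
        split x core x≤n = begin
          sum (map w (sSet s x)) ℕ.+ weigh w x n        ≡⟨ sum-++ (map w (sSet s x)) _ ⟨
          sum (map w (sSet s x) ++ map w (betas x n))   ≡⟨ cong sum (map-++ w (sSet s x) (betas x n)) ⟨
          sum (map w (sSet s x ++ betas x n))           ≡⟨ sum-↭ (map⁺ w (sSet-betas x core n x≤n)) ⟩
          sum (map w (map (_+ + s) (betas x (s ℕ.+ n)))) ≡⟨ cong sum (map-∘ (betas x (s ℕ.+ n))) ⟨
          weigh (w ∘ (_+ + s)) x (s ℕ.+ n)              ∎

      invariant-multiple : ∀ {d} → Invariant d → ∀ k → Invariant (+ k * d)
      invariant-multiple {d} inv zero {w} _ = excess-cong n λ x → cong w (ℤₚ.+-identityʳ x)
      invariant-multiple {d} inv (suc k) {w} periodic = begin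
        excess n (λ x → w (x + (1ℤ + + k) * d))  ≡⟨ excess-cong n (λ x → cong w (step x (+ k) d)) ⟩
        excess n (λ x → w (x + d + + k * d))     ≡⟨ inv (periodic-shift periodic (+ k * d)) ⟩
        excess n (λ x → w (x + + k * d))         ≡⟨ invariant-multiple inv k periodic ⟩
        excess n w                               ∎
        where
        open ≡-Reasoning
        step : ∀ x k d → x + (1ℤ + k) * d ≡ x + d + k * d
        step = solve-∀

      -- By Bézout, 1 or -1 is congruent modulo `t` to a natural multiple of `s`, and multiples of
      -- `t` do not affect periodic functions.
      invariant-1 : Invariant 1ℤ
      invariant-1 {w} periodic with coprime-Bézout coprime
      ... | Bézout.+- x y eq = begin
        excess n (w ∘ (_+ 1ℤ))          ≡⟨ excess-cong n (λ z → trans (sym (periodic-* periodic (z + 1ℤ) (+ y))) (cong w (bezout z))) ⟩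
        excess n (w ∘ (_+ + x * + s))   ≡⟨ invariant-multiple invariant-s x periodic ⟩
        excess n w                      ∎
        where
        open ≡-Reasoning
        bezout : ∀ z → z + 1ℤ + + y * + t ≡ z + + x * + s
        bezout z = trans (ℤₚ.+-assoc z 1ℤ (+ y * + t)) (cong (λ a → z + a)
          (trans (cong (λ z → 1ℤ + z) (sym (ℤₚ.pos-* y t))) (trans (cong +_ eq) (ℤₚ.pos-* x s))))
      -- Here `x * s` is congruent to -1, so the translation by it is applied to the translate of
      -- `w` by 1 and brings that back to `w`.
      ... | Bézout.-+ x y eq = begin
        excess n (w ∘ (_+ 1ℤ))                   ≡⟨ invariant-multiple invariant-s x (periodic-shift periodic 1ℤ) ⟨
        excess n (λ z → w (z + + x * + s + 1ℤ))  ≡⟨ excess-cong n (λ z → trans (cong w (bezout z)) (periodic-* periodic z (+ y))) ⟩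
        excess n w                               ∎
        where
        open ≡-Reasoning
        bezout : ∀ z → z + + x * + s + 1ℤ ≡ z + + y * + t
        bezout z = trans (ℤₚ.+-assoc z (+ x * + s) 1ℤ) (cong (λ a → z + a)
          (trans (ℤₚ.+-comm (+ x * + s) 1ℤ)
          (trans (cong (λ z → 1ℤ + z) (sym (ℤₚ.pos-* x s))) (trans (cong +_ eq) (ℤₚ.pos-* y t)))))

      -- For `k = t` the window meets each residue class exactly once.
      windowSum : (ℤ → ℕ) → ℕ → ℤ → ℕ
      windowSum w zero    x = 0
      windowSum w (suc k) x = windowSum w k x ℕ.+ w (x + + k)

      -- The window sum adds `k` translates of `w`, and each has the same excess as `w`.
      excess-windowSum : ∀ {w} → Periodic t w → ∀ k → excess n (windowSum w k) ≡ + k * excess n w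
      excess-windowSum {w} periodic zero = ℤₚ.i≡j⇒i-j≡0 (cong +_ (weigh-const 0 p q n))
      excess-windowSum {w} periodic (suc k) = begin
        excess n (windowSum w (suc k))                       ≡⟨ excess-+ n (windowSum w k) (w ∘ (_+ + k)) ⟩
        excess n (windowSum w k) + excess n (w ∘ (_+ + k))   ≡⟨ cong₂ _+_ (excess-windowSum periodic k) invariant-k ⟩
        + k * excess n w + excess n w                        ≡⟨ step (+ k) (excess n w) ⟩
        + suc k * excess n w                                 ∎
        where
        open ≡-Reasoning
        step : ∀ k e → k * e + e ≡ (1ℤ + k) * e
        step = solve-∀
        invariant-k : excess n (w ∘ (_+ + k)) ≡ excess n w
        invariant-k = trans (excess-cong n λ x → cong (λ a → w (x + a)) (sym (ℤₚ.*-identityʳ (+ k))))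
                            (invariant-multiple invariant-1 k periodic)

      -- Sliding the window gains its new right end and loses `w x`; the loss is added on the left
      -- to stay within ℕ.
      windowSum-slide : ∀ w k x → windowSum w k (x + 1ℤ) ℕ.+ w x ≡ windowSum w k x ℕ.+ w (x + + k)
      windowSum-slide w zero x = cong w (sym (ℤₚ.+-identityʳ x))
      windowSum-slide w (suc k) x = begin
        windowSum w k (x + 1ℤ) ℕ.+ w (x + 1ℤ + + k) ℕ.+ w x   ≡⟨ xy∙z≈xz∙y (windowSum w k (x + 1ℤ)) _ (w x) ⟩
        windowSum w k (x + 1ℤ) ℕ.+ w x ℕ.+ w (x + 1ℤ + + k)   ≡⟨ cong₂ ℕ._+_ (windowSum-slide w k x) (cong w (ℤₚ.+-assoc x 1ℤ (+ k))) ⟩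
        windowSum w k x ℕ.+ w (x + + k) ℕ.+ w (x + + suc k)   ∎
        where
        open ≡-Reasoning

      -- The sum of w over a window of length t is constant, so its excess, t times that of w, is 0.
      weigh-equal : ∀ {w} → Periodic t w → weigh w p n ≡ weigh w q n
      weigh-equal {w} periodic with ℤₚ.i*j≡0⇒i≡0∨j≡0 (+ t) t*excess≡0
        where
        constant : ∀ x → windowSum w t x ≡ windowSum w t 0ℤ
        -- By `windowSum-slide` and the period `t` of `w` the window sum has period 1, so its value
        -- at `x = 0 + x * 1` is its value at 0.
        constant x = trans (cong (windowSum w t) (sym (trans (ℤₚ.+-identityˡ (x * 1ℤ)) (ℤₚ.*-identityʳ x))))
          (periodic-* {t = 1} (λ x → ℕₚ.+-cancelʳ-≡ (w x) _ _
            (trans (windowSum-slide w t x) (cong (windowSum w t x ℕ.+_) (periodic x)))) 0ℤ x)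
        t*excess≡0 : + t * excess n w ≡ 0ℤ
        t*excess≡0 = begin
          + t * excess n w                      ≡⟨ excess-windowSum periodic t ⟨
          excess n (windowSum w t)              ≡⟨ excess-cong n constant ⟩
          excess n (λ _ → windowSum w t 0ℤ)     ≡⟨ ℤₚ.i≡j⇒i-j≡0 (cong +_ (weigh-const _ p q n)) ⟩
          0ℤ                                    ∎
          where open ≡-Reasoning
      ... | inj₁ t≡0 = contradiction (ℤₚ.+-injective t≡0) (ℕ.≢-nonZero⁻¹ t)
      ... | inj₂ excess≡0 = ℤₚ.+-injective (ℤₚ.i-j≡0⇒i≡j _ _ excess≡0)

-- Recovering a core from its bead counts

-- Pigeonhole: delete one occurrence of the head from `ys`; the other elements of `xs` differ from
-- it and remain.
unique-⊆⇒length≤ : ∀ {A : Set} {xs ys : List A} → Unique xs → (∀ {x} → x ∈ xs → x ∈ ys) →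
                   length xs ≤ length ys
unique-⊆⇒length≤ [] _ = z≤n
unique-⊆⇒length≤ {xs = x ∷ xs} (x∉xs ∷ unique) ⊆ys with ∈-∃++ (⊆ys (here refl))
... | as , bs , refl = begin
  suc (length xs)            ≤⟨ s≤s (unique-⊆⇒length≤ unique ⊆rest) ⟩
  suc (length (as ++ bs))    ≡⟨ ↭-length (shift x as bs) ⟨
  length (as ++ x ∷ bs)      ∎
  where
  open ℕₚ.≤-Reasoning
  ⊆rest : ∀ {y} → y ∈ xs → y ∈ as ++ bs
  ⊆rest y∈xs with ∈-resp-↭ (shift x as bs) (⊆ys (there y∈xs))
  ... | here refl = contradiction refl (All.lookup x∉xs y∈xs)
  ... | there y∈  = y∈

-- Writes the size of a residue class as a weight, so that equality of weights applies to it.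
length-filter : ∀ {A : Set} {P : Pred A 0ℓ} (P? : Decidable P) xs →
  length (filter P? xs) ≡ sum (map (λ x → if does (P? x) then 1 else 0) xs)
length-filter P? [] = refl
length-filter P? (x ∷ xs) with does (P? x)
... | true  = cong suc (length-filter P? xs)
... | false = length-filter P? xs

++-cancelˡ-↭ : ∀ {A : Set} (xs : List A) {ys zs} → xs ++ ys ↭ xs ++ zs → ys ↭ zs
++-cancelˡ-↭ []       perm = perm
++-cancelˡ-↭ (x ∷ xs) perm = ++-cancelˡ-↭ xs (drop-∷ perm)

core⇒beta-shift-* : ∀ {t} .{{_ : NonZero t}} p → IsCore t p → ∀ k {x} → BetaSet p x → BetaSet p (x - + k * + t)
core⇒beta-shift-* p core zero {x} x∈B = subst (BetaSet p) (sym (ℤₚ.+-identityʳ x)) x∈B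
core⇒beta-shift-* {t} p core (suc k) {x} x∈B = subst (BetaSet p) (step x (+ k) (+ t))
  (core⇒beta-shift p core _ (core⇒beta-shift-* p core k x∈B))
  where
  step : ∀ x k t → x - k * t - t ≡ x - (1ℤ + k) * t
  step = solve-∀

/ℕ-difference : ∀ t .{{_ : NonZero t}} x y → x %ℕ t ≡ y %ℕ t → x /ℕ t ℤ.≤ y /ℕ t → x ≡ y - + ∣ y /ℕ t - x /ℕ t ∣ * + t
/ℕ-difference t x y eq le = begin
  x                                            ≡⟨ a≡a%ℕn+[a/ℕn]*n x t ⟩
  + (x %ℕ t) + x /ℕ t * + t                    ≡⟨ cong (λ r → + r + x /ℕ t * + t) eq ⟩
  + (y %ℕ t) + x /ℕ t * + t                    ≡⟨ regroup (+ (y %ℕ t)) (x /ℕ t) (y /ℕ t) (+ t) ⟩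
  + (y %ℕ t) + y /ℕ t * + t - (y /ℕ t - x /ℕ t) * + t
    ≡⟨ cong₂ (λ a b → a - b * + t) (a≡a%ℕn+[a/ℕn]*n y t) (ℤₚ.0≤i⇒+∣i∣≡i (ℤₚ.i≤j⇒0≤j-i le)) ⟨
  y - + ∣ y /ℕ t - x /ℕ t ∣ * + t              ∎
  where
  open ≡-Reasoning
  regroup : ∀ r a b t → r + a * t ≡ r + b * t - (b - a) * t
  regroup = solve-∀

-- Congruent integers are compared by their quotients; the lower one is reached from the other by
-- natural multiples of `t`, as `core⇒beta-shift-*` requires.
%-≡⇒multiple : ∀ t .{{_ : NonZero t}} x y → x %ℕ t ≡ y %ℕ t →
  (∃[ k ] x ≡ y - + k * + t) ⊎ (∃[ k ] y ≡ x - + k * + t)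
%-≡⇒multiple t x y eq with ℤₚ.≤-total (x /ℕ t) (y /ℕ t)
... | inj₁ le = inj₁ (∣ y /ℕ t - x /ℕ t ∣ , /ℕ-difference t x y eq le)
... | inj₂ ge = inj₂ (∣ x /ℕ t - y /ℕ t ∣ , /ℕ-difference t y x (sym eq) ge)

-- If x were a bead of p but not of q, then every bead of q congruent to x would lie below x and
-- hence be a bead of p, so p would have more beads than q in that residue class.
cores-⊆ : ∀ {t} .{{_ : NonZero t}} p q → IsCore t p → IsCore t q → ∀ {n} → bound p ≤ n → bound q ≤ n →
  (∀ {w} → Periodic t w → weigh w p n ≡ weigh w q n) → ∀ {x} → BetaSet p x → BetaSet q x
cores-⊆ {t} p q p-core q-core {n} p≤n q≤n weigh≡ {x} x∈p with betaSet? q x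
... | yes x∈q = x∈q
... | no x∉q = contradiction more (ℕₚ.≤⇒≯ (ℕₚ.≤-reflexive counts))
  where
  congruent? : Decidable (λ y → y %ℕ t ≡ x %ℕ t)
  congruent? y = y %ℕ t ℕₚ.≟ x %ℕ t
  class : Partition → List ℤ
  class z = filter congruent? (betas z n)
  counts : length (class p) ≡ length (class q)
  counts = begin
    length (class p)   ≡⟨ length-filter congruent? (betas p n) ⟩
    weigh indicator p n ≡⟨ weigh≡ (λ y → cong (λ r → if does (r ℕₚ.≟ x %ℕ t) then 1 else 0) (%-periodic t y)) ⟩
    weigh indicator q n ≡⟨ length-filter congruent? (betas q n) ⟨
    length (class q)   ∎
    where
    open ≡-Reasoning
    indicator : ℤ → ℕ
    indicator y = if does (congruent? y) then 1 else 0
  agree : ∀ {i} → n ≤ i → beta q i ≡ beta p i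
  agree n≤i = beta-agree q p (ℕₚ.≤-trans q≤n n≤i) (ℕₚ.≤-trans p≤n n≤i)
  -- From index `n` on the beads of `p` and `q` agree, so a bead of `p` missing from `q` appears in
  -- the truncation.
  low : ∀ {i} → ¬ BetaSet q (beta p i) → i < n
  low ∉q = ℕₚ.≰⇒> λ n≤i → ∉q (_ , agree n≤i)
  x∈class : x ∈ class p
  x∈class = let i , eq = x∈p in ∈-filter⁺ congruent?
    (subst (_∈ betas p n) eq (∈-applyDownFrom⁺ (beta p) (low (subst (¬_ ∘ BetaSet q) (sym eq) x∉q)))) refl
  below : ∀ {y} → BetaSet q y → y %ℕ t ≡ x %ℕ t → BetaSet p y
  below {y} y∈q eq with %-≡⇒multiple t y x eq
  ... | inj₁ (k , y≡) = subst (BetaSet p) (sym y≡) (core⇒beta-shift-* p p-core k x∈p)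
  ... | inj₂ (k , x≡) = contradiction (subst (BetaSet q) (sym x≡) (core⇒beta-shift-* q q-core k y∈q)) x∉q
  class-⊆ : ∀ {y} → y ∈ class q → y ∈ class p
  class-⊆ {y} y∈ with ∈-filter⁻ congruent? {xs = betas q n} y∈
  ... | y∈q , y≡x with ∈-applyDownFrom⁻ (beta q) y∈q
  ...   | j , j<n , refl with below (j , refl) y≡x
  ...     | i , eq = ∈-filter⁺ congruent? (subst (_∈ betas p n) eq (∈-applyDownFrom⁺ (beta p) (ℕₚ.≰⇒> n≰i))) y≡x
    where
    n≰i : ¬ (n ≤ i)
    n≰i n≤i = ℕₚ.<⇒≱ j<n (subst (n ≤_) (beta-injective q (trans (agree n≤i) eq)) n≤i)
  more : length (class q) < length (class p)
  -- The list `x ∷ class q` has no repetitions and lies inside `class p`; the extra `x` makes the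
  -- inequality strict.
  more = unique-⊆⇒length≤ {xs = x ∷ class q}
    (All.tabulate (λ y∈ x≡y → x∉q (bead (subst (_∈ class q) (sym x≡y) y∈))) ∷ Uniqueₚ.filter⁺ congruent? (betas-unique q n))
    λ { (here refl) → x∈class ; (there y∈) → class-⊆ y∈ }
    where
    bead : ∀ {y} → y ∈ class q → BetaSet q y
    bead y∈ with ∈-applyDownFrom⁻ (beta q) (proj₁ (∈-filter⁻ congruent? {xs = betas q n} y∈))
    ... | j , _ , y≡ = j , sym y≡

-- The beads of `p` occur among those of `q` at strictly increasing positions, so bead `i` of `p`
-- has position at least `i` in `q`.
betaSet-⊆⇒beta-≤ : ∀ p q → (∀ {x} → BetaSet p x → BetaSet q x) → ∀ i → beta p i ℤ.≤ beta q i
betaSet-⊆⇒beta-≤ p q ⊆q i = let j , i≤j , eq = position i in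
  subst (ℤ._≤ beta q i) eq (beta-antitone q i≤j)
  where
  position : ∀ i → ∃[ j ] i ≤ j × beta q j ≡ beta p i
  position zero = let j , eq = ⊆q (0 , refl) in j , z≤n , eq
  position (suc i) =
    let j , i≤j , eq = position i
        k , eq′ = ⊆q (suc i , refl)
    in k , ℕₚ.≤-<-trans i≤j (beta-cancel-< q (subst₂ ℤ._<_ (sym eq′) (sym eq) (beta-strict p (ℕₚ.n<1+n i)))) , eq′

betaSet-≡⇒≈ : ∀ p q → (∀ {x} → BetaSet p x → BetaSet q x) → (∀ {x} → BetaSet q x → BetaSet p x) → p ≈ q
betaSet-≡⇒≈ p q ⊆q ⊆p i = ℤₚ.+-injective (+-cancelʳ (- + suc i) _ _
  (ℤₚ.≤-antisym (betaSet-⊆⇒beta-≤ p q ⊆q i) (betaSet-⊆⇒beta-≤ q p ⊆p i)))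

betas-cong : ∀ p q → p ≈ q → ∀ n → betas p n ≡ betas q n
betas-cong p q p≈q zero    = refl
betas-cong p q p≈q (suc n) = cong₂ _∷_ (cong (λ a → + a - + suc n) (p≈q n)) (betas-cong p q p≈q n)

-- Equal residues and equal `t`-cores

module _ {s t : ℕ} .{{_ : NonZero s}} .{{_ : NonZero t}} (p q pᵗ qᵗ : Partition)
         (p-core : IsCore s p) (q-core : IsCore s q) (pᵗ-coreOf : IsCoreOf t p pᵗ) (qᵗ-coreOf : IsCoreOf t q qᵗ) where

  -- Periodic weights pass unchanged from `pᵗ` to `p`, from `p` to `q` by `weigh-equal`, and from
  -- `q` to `qᵗ`; then `cores-⊆` applies in both directions.
  residues⇒≈ : Coprime s t → residues s t p ↭ residues s t q → pᵗ ≈ qᵗ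
  residues⇒≈ coprime perm with coreOf-betas (proj₁ pᵗ-coreOf) (%-periodic t) | coreOf-betas (proj₁ qᵗ-coreOf) (%-periodic t)
  ... | N , p≤N , pᵗ≤N , p-perm | M , q≤M , qᵗ≤M , q-perm =
    betaSet-≡⇒≈ pᵗ qᵗ
      (cores-⊆ pᵗ qᵗ (proj₂ pᵗ-coreOf) (proj₂ qᵗ-coreOf) (ℕₚ.≤-trans pᵗ≤N N≤n) (ℕₚ.≤-trans qᵗ≤M M≤n) weigh≡)
      (cores-⊆ qᵗ pᵗ (proj₂ qᵗ-coreOf) (proj₂ pᵗ-coreOf) (ℕₚ.≤-trans qᵗ≤M M≤n) (ℕₚ.≤-trans pᵗ≤N N≤n) (sym ∘ weigh≡))
    where
    n = N ⊔ M
    N≤n = ℕₚ.m≤m⊔n N M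
    M≤n = ℕₚ.m≤n⊔m N M
    weigh≡ : ∀ {w} → Periodic t w → weigh w pᵗ n ≡ weigh w qᵗ n
    weigh≡ {w} periodic = begin
      weigh w pᵗ n ≡⟨ sum-↭ (↭-periodic t periodic {betas pᵗ n} {betas p n} (p-perm n N≤n)) ⟩
      weigh w p n  ≡⟨ weigh-equal p q (ℕₚ.≤-trans p≤N N≤n) (ℕₚ.≤-trans q≤M M≤n) coprime p-core q-core perm periodic ⟩
      weigh w q n  ≡⟨ sum-↭ (↭-periodic t periodic {betas qᵗ n} {betas q n} (q-perm n M≤n)) ⟨
      weigh w qᵗ n ∎
      where open ≡-Reasoning

  -- Equal `t`-cores make the bead residues of `p` and `q` agree in every late truncation, hence
  -- also after translation by `s`. Cancelling the beads from the shifted beads leaves the residues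
  -- of the `s`-sets.
  ≈⇒residues : pᵗ ≈ qᵗ → residues s t p ↭ residues s t q
  ≈⇒residues pᵗ≈qᵗ with coreOf-betas (proj₁ pᵗ-coreOf) (%-periodic t) | coreOf-betas (proj₁ qᵗ-coreOf) (%-periodic t)
  ... | N , p≤N , _ , p-perm | M , q≤M , _ , q-perm = ++-cancelˡ-↭ (map (_%ℕ t) (betas p n)) (begin
    map (_%ℕ t) (betas p n) ++ residues s t p  ↭⟨ ++-comm (map (_%ℕ t) (betas p n)) (residues s t p) ⟩
    residues s t p ++ map (_%ℕ t) (betas p n)  ↭⟨ split p p-core (ℕₚ.≤-trans p≤N N≤n) ⟩
    map f (betas p (s ℕ.+ n))                  ↭⟨ ↭-periodic t (periodic-shift (%-periodic t) (+ s)) {betas p (s ℕ.+ n)} {betas q (s ℕ.+ n)} (same (s ℕ.+ n) (ℕₚ.m≤n+m n s)) ⟩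
    map f (betas q (s ℕ.+ n))                  ↭⟨ split q q-core (ℕₚ.≤-trans q≤M M≤n) ⟨
    residues s t q ++ map (_%ℕ t) (betas q n)  ↭⟨ ++⁺ˡ (residues s t q) (same n ℕₚ.≤-refl) ⟨
    residues s t q ++ map (_%ℕ t) (betas p n)  ↭⟨ ++-comm (residues s t q) (map (_%ℕ t) (betas p n)) ⟩
    map (_%ℕ t) (betas p n) ++ residues s t q  ∎)
    where
    open PermutationReasoning
    n = N ⊔ M
    N≤n = ℕₚ.m≤m⊔n N M
    M≤n = ℕₚ.m≤n⊔m N M
    f : ℤ → ℕ
    f = (_%ℕ t) ∘ (_+ + s)
    same : ∀ k → n ≤ k → map (_%ℕ t) (betas p k) ↭ map (_%ℕ t) (betas q k)
    same k n≤k = begin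
      map (_%ℕ t) (betas p k)    ↭⟨ p-perm k (ℕₚ.≤-trans N≤n n≤k) ⟨
      map (_%ℕ t) (betas pᵗ k)   ≡⟨ cong (map (_%ℕ t)) (betas-cong pᵗ qᵗ pᵗ≈qᵗ k) ⟩
      map (_%ℕ t) (betas qᵗ k)   ↭⟨ q-perm k (ℕₚ.≤-trans M≤n n≤k) ⟩
      map (_%ℕ t) (betas q k)    ∎
    split : ∀ x → IsCore s x → bound x ≤ n → residues s t x ++ map (_%ℕ t) (betas x n) ↭ map f (betas x (s ℕ.+ n))
    split x core x≤n = begin
      residues s t x ++ map (_%ℕ t) (betas x n)          ≡⟨ map-++ (_%ℕ t) (sSet s x) (betas x n) ⟨
      map (_%ℕ t) (sSet s x ++ betas x n)                ↭⟨ map⁺ (_%ℕ t) (sSet-betas x core n x≤n) ⟩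
      map (_%ℕ t) (map (_+ + s) (betas x (s ℕ.+ n)))     ≡⟨ map-∘ (betas x (s ℕ.+ n)) ⟨
      map f (betas x (s ℕ.+ n))                          ∎

proposition3p6 : (s t : ℕ) .{{_ : NonZero s}} .{{_ : NonZero t}} → Coprime s t →
    (∀ (p q pᵗ qᵗ : Partition) → IsCore s p → IsCore s q →
    IsCoreOf t p pᵗ → IsCoreOf t q qᵗ →
    residues s t p ↭ residues s t q → pᵗ ≈ qᵗ)
    × (∀ (p q pᵗ qᵗ : Partition) → IsCore s p → IsCore s q →
    IsCoreOf t p pᵗ → IsCoreOf t q qᵗ →
    (pᵗ ≈ qᵗ) ⇔ (residues s t p ↭ residues s t q))
proposition3p6 s t coprime =
  (λ p q pᵗ qᵗ p-core q-core pᵗ-coreOf qᵗ-coreOf →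
    residues⇒≈ p q pᵗ qᵗ p-core q-core pᵗ-coreOf qᵗ-coreOf coprime) ,
  (λ p q pᵗ qᵗ p-core q-core pᵗ-coreOf qᵗ-coreOf → mk⇔
    (≈⇒residues p q pᵗ qᵗ p-core q-core pᵗ-coreOf qᵗ-coreOf)
    (residues⇒≈ p q pᵗ qᵗ p-core q-core pᵗ-coreOf qᵗ-coreOf coprime))
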